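{- For any odd prime $p$, any integer $\alpha\ge1$ and any integer $n\ge0$, \[ b_4\!\left(p^{2\alpha}n+\frac{(8i+p)p^{2\alpha-1}-1}{8}\right)\equiv 0 \pmod 2 \] for each $i=1,2,\ldots,p-1$.
   Context: For a positive integer $\ell$, $b_\ell(n)$ denotes the number of partitions of $n$ having no part divisible by $\ell$. -}

module Defs where

open import Data.List using (List; []; _∷_; [_]; _++_; map; filter; length)
open import Data.List.Membership.Propositional using (_∈_)
open import Data.List.Membership.Propositional.Properties
  using (∈-++⁺ˡ; ∈-++⁺ʳ; ∈-++⁻; ∈-map⁺; ∈-map⁻)
open import Data.List.Properties using (∷-injectiveʳ)
open import Data.List.Relation.Unary.All as All using (All; []; _∷_; all?)
open import Data.List.Relation.Unary.AllPairs using ([]; _∷_)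
open import Data.List.Relation.Unary.Any using (here)
open import Data.List.Relation.Unary.Linked as Linked using (Linked; []; [-]; _∷_)
open import Data.List.Relation.Unary.Unique.Propositional using (Unique)
open import Data.List.Relation.Unary.Unique.Propositional.Properties using (map⁺; ++⁺)
open import Data.Nat
  using (ℕ; zero; suc; _+_; _∸_; _≤_; _<_; _≥_; _≤?_; z≤n; s≤s; s≤s⁻¹)
open import Data.Nat.Divisibility using (_∣_; _∣?_)
open import Data.Nat.ListAction using (sum)
open import Data.Nat.Properties
open import Data.Product using (_×_; _,_; proj₁; proj₂)
open import Data.Sum using (inj₁; inj₂)
open import Relation.Binary.PropositionalEquality using (_≡_; refl; sym; trans; cong; subst)
open import Relation.Nullary using (¬_; yes; no; ¬?; contradiction)
open import Relation.Unary using (Decidable)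

record IsPartition (n : ℕ) (xs : List ℕ) : Set where
  constructor isPartition
  field
    nonincreasing : Linked _≥_ xs
    positive      : All (0 <_) xs
    total         : sum xs ≡ n

Regular : ℕ → List ℕ → Set
Regular ℓ = All (λ x → ¬ (ℓ ∣ x))

regular? : ∀ ℓ → Decidable (Regular ℓ)
regular? ℓ = all? (λ x → ¬? (ℓ ∣? x))

-- The partitions of n with all parts at most m, split according to whether
-- m occurs.  The first argument is fuel: any value ≥ n gives the full list.
mutual
  partitions≤ : (fuel m n : ℕ) → List (List ℕ)
  partitions≤ f       m       zero    = [ [] ]
  partitions≤ f       zero    (suc n) = []
  partitions≤ zero    (suc m) (suc n) = []
  partitions≤ (suc f) (suc m) (suc n) =
    partitions≤ (suc f) m (suc n) ++ withPart f m n

  -- The partitions of suc n with largest part exactly suc m.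
  withPart : (fuel m n : ℕ) → List (List ℕ)
  withPart f m n with m ≤? n
  ... | yes _ = map (suc m ∷_) (partitions≤ f (suc m) (n ∸ m))
  ... | no  _ = []

partitions : ℕ → List (List ℕ)
partitions n = partitions≤ n n n

b : ℕ → ℕ → ℕ
b ℓ n = length (filter (regular? ℓ) (partitions n))

------------------------------------------------------------------------
-- `partitions n` lists every partition of n exactly once.

private
  linked-cons : ∀ {x xs} → All (_≤ x) xs → Linked _≥_ xs → Linked _≥_ (x ∷ xs)
  linked-cons []      []  = [-]
  linked-cons (p ∷ _) lxs = p ∷ lxs

  linked-bound : ∀ {x xs} → Linked _≥_ (x ∷ xs) → All (_≤ x) xs
  linked-bound [-]       = []
  linked-bound (p ∷ lxs) = p ∷ All.map (λ q → ≤-trans q p) (linked-bound lxs)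

mutual
  partitions≤-sound : ∀ f m n {xs} → xs ∈ partitions≤ f m n →
                      IsPartition n xs × All (_≤ m) xs
  partitions≤-sound f       m       zero    (here refl) = isPartition [] [] refl , []
  partitions≤-sound (suc f) (suc m) (suc n) xs∈ with ∈-++⁻ (partitions≤ (suc f) m (suc n)) xs∈
  ... | inj₁ p = let π , bd = partitions≤-sound (suc f) m (suc n) p
                 in π , All.map m≤n⇒m≤1+n bd
  ... | inj₂ p = withPart-sound f m n p

  withPart-sound : ∀ f m n {xs} → xs ∈ withPart f m n →
                   IsPartition (suc n) xs × All (_≤ suc m) xs
  withPart-sound f m n xs∈ with m ≤? n
  ... | yes m≤n with ∈-map⁻ (suc m ∷_) xs∈
  ...   | ys , ys∈ , refl with partitions≤-sound f (suc m) (n ∸ m) ys∈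
  ...     | isPartition l pos tot , bd =
    isPartition (linked-cons bd l) (s≤s z≤n ∷ pos)
      (cong suc (trans (cong (m +_) tot) (m+[n∸m]≡n m≤n)))
    , ≤-refl ∷ bd

partitions≤-complete : ∀ f m n {xs} → n ≤ f → IsPartition n xs → All (_≤ m) xs →
                       xs ∈ partitions≤ f m n
partitions≤-complete f m zero {[]} _ _ _ = here refl
partitions≤-complete f m zero {zero ∷ _} _ (isPartition _ (() ∷ _) _) _
partitions≤-complete f m (suc n) {zero ∷ _} _ (isPartition _ (() ∷ _) _) _
partitions≤-complete f zero (suc n) {suc x ∷ xs} _ _ (() ∷ _)
partitions≤-complete (suc f) (suc m) (suc n) {suc x ∷ xs} n≤f
  π@(isPartition l (_ ∷ pos) tot) (x≤m ∷ _) with m ≤? x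
... | no  m≰x =
  ∈-++⁺ˡ (partitions≤-complete (suc f) m (suc n) n≤f π
    (≰⇒> m≰x ∷ All.map (λ q → ≤-trans q (≰⇒> m≰x)) (linked-bound l)))
... | yes m≤x with ≤-antisym (s≤s⁻¹ x≤m) m≤x
...   | refl = ∈-++⁺ʳ (partitions≤ (suc f) m (suc n)) inPart
  where
  x+s≡n : m + sum xs ≡ n
  x+s≡n = suc-injective tot

  s≡n∸m : sum xs ≡ n ∸ m
  s≡n∸m = trans (sym (m+n∸m≡n m (sum xs))) (cong (_∸ m) x+s≡n)

  inPart : (suc m ∷ xs) ∈ withPart f m n
  inPart with m ≤? n
  ... | yes _   = ∈-map⁺ (suc m ∷_)
    (partitions≤-complete f (suc m) (n ∸ m) (≤-trans (m∸n≤m n m) (s≤s⁻¹ n≤f))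
      (isPartition (Linked.tail l) pos s≡n∸m) (linked-bound l))
  ... | no  m≰n = contradiction (subst (m ≤_) x+s≡n (m≤m+n m (sum xs))) m≰n

mutual
  partitions≤-unique : ∀ f m n → Unique (partitions≤ f m n)
  partitions≤-unique f       m       zero    = [] ∷ []
  partitions≤-unique f       zero    (suc n) = []
  partitions≤-unique zero    (suc m) (suc n) = []
  partitions≤-unique (suc f) (suc m) (suc n) =
    ++⁺ (partitions≤-unique (suc f) m (suc n)) (withPart-unique f m n)
        (λ (p , q) → disjoint p q)
    where
    disjoint : ∀ {xs} → xs ∈ partitions≤ (suc f) m (suc n) → ¬ (xs ∈ withPart f m n)
    disjoint p q with m ≤? n
    ... | yes _ with ∈-map⁻ (suc m ∷_) q
    ...   | _ , _ , refl with partitions≤-sound (suc f) m (suc n) p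
    ...     | _ , m<m ∷ _ = 1+n≰n m<m

  withPart-unique : ∀ f m n → Unique (withPart f m n)
  withPart-unique f m n with m ≤? n
  ... | yes _ = map⁺ ∷-injectiveʳ (partitions≤-unique f (suc m) (n ∸ m))
  ... | no  _ = []

partitions-sound : ∀ n {xs} → xs ∈ partitions n → IsPartition n xs
partitions-sound n xs∈ = proj₁ (partitions≤-sound n n n xs∈)

partitions-complete : ∀ n {xs} → IsPartition n xs → xs ∈ partitions n
partitions-complete n {xs} π = partitions≤-complete n n n ≤-refl π
  (subst (λ k → All (_≤ k) xs) (IsPartition.total π) (parts≤sum xs))
  where
  parts≤sum : ∀ ys → All (_≤ sum ys) ys
  parts≤sum []       = []
  parts≤sum (y ∷ ys) =
    m≤m+n y (sum ys) ∷ All.map (λ q → ≤-trans q (m≤n+m (sum ys) y)) (parts≤sum ys)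

partitions-unique : ∀ n → Unique (partitions n)
partitions-unique n = partitions≤-unique n n n

module Submission where

-- Modulo 2 the generating function of b 4 is ∏ (1 + q^4k) / (1 + q^k), which
-- equals ∏ (1 + q^2k)² / (1 + q^k).  By Gauss this is Σ q^(j(j+1)/2), so b 4 N
-- is even unless 8N + 1 is a square.  For the N of the theorem,
-- 8N + 1 = p^(2α-1) (8(pn + i) + p), in which p occurs to an odd power.
-- Gauss's identity is reached through the finite, telescoping version of
-- D. Shanks, which holds in any commutative semiring in which 1 + 1 = 0.

open import Algebra.Bundles using (CommutativeRing; CommutativeSemiring)
import Algebra.Properties.CommutativeSemigroup as CommutativeSemigroupProperties
import Algebra.Properties.CommutativeSemiring.Exp as CommutativeSemiringExp
open import Algebra.Structures.Biased using (isCommutativeSemiringˡ)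
open import Data.List using (List; []; _∷_; map; filter; length; _++_)
open import Data.List.Properties using (filter-++; length-++)
open import Data.Nat as ℕ using (ℕ; zero; suc; _≤_; _<_; z≤n; s≤s; s≤s⁻¹; _/_; NonZero; parity)
import Data.Nat.Properties as ℕ
open import Data.Nat.Divisibility
open import Data.Nat.DivMod using (m*n/n≡m)
open import Data.Nat.Primality using
  (Prime; euclidsLemma; prime⇒nonZero; prime⇒irreducible; prime[2]; ¬prime[1])
open import Data.Nat.Tactic.RingSolver using (solve-∀)
open import Data.Parity using (Parity; 0ℙ; 1ℙ) renaming (_+_ to _⊞_)
import Data.Parity.Properties as ℙ
open import Data.Product using (∃; _,_; proj₁; proj₂)
open import Data.Sum using (inj₁; inj₂; [_,_]′)
open import Function using (id; _∘_)
open import Level using (0ℓ)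
import Relation.Binary.PropositionalEquality as ≡
open ≡ using (_≡_; _≢_; _≗_)
open import Relation.Binary.Structures using (IsEquivalence)
open import Relation.Nullary using (¬_; yes; no; contradiction)
open import Relation.Nullary.Decidable using (from-no)
open import Defs

-- Shanks's finite form of Gauss's identity in characteristic two

CharacteristicTwo : ∀ {c ℓ} → CommutativeSemiring c ℓ → Set ℓ
CharacteristicTwo R = 1# + 1# ≈ 0#
  where open CommutativeSemiring R

module Shanks {c ℓ} (R : CommutativeSemiring c ℓ) (1+1≈0 : CharacteristicTwo R)
  (x : CommutativeSemiring.Carrier R) where

  open CommutativeSemiring R
  open CommutativeSemiringExp R
  open CommutativeSemigroupProperties *-commutativeSemigroup using (interchange; xy∙z≈xz∙y)
  open import Algebra.Solver.Ring.NaturalCoefficients.Default R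
  open import Relation.Binary.Reasoning.Setoid setoid

  a+a≈0 : ∀ a → a + a ≈ 0#
  a+a≈0 a = begin
    a + a          ≈⟨ solve 1 (λ a → a :+ a := a :* (con 1 :+ con 1)) refl a ⟩
    a * (1# + 1#)  ≈⟨ *-congˡ 1+1≈0 ⟩
    a * 0#         ≈⟨ zeroʳ a ⟩
    0#             ∎

  q : ℕ → Carrier
  q n = x * (x * x) ^ n

  odd even : ℕ → Carrier
  odd k  = 1# + q k
  even k = 1# + (x * x) ^ suc k

  O E : ℕ → Carrier
  O zero    = 1#
  O (suc n) = O n * odd n
  E zero    = 1#
  E (suc n) = E n * even n

  -- The identity concerns P n = E n / O n; multiplying it by O n clears the
  -- denominators, and C s d stands for O n · P n / P s with n = s + d.
  C : ℕ → ℕ → Carrier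
  C s zero    = O s
  C s (suc d) = C s d * even (d ℕ.+ s)

  -- For n = s + d and w = q n = x^(2n+1) this is O n · Σ P n / P t · x^(t(2n+1))
  -- over s ≤ t < n, the tail of Shanks's sum.
  tail : Carrier → ℕ → ℕ → Carrier
  tail w s zero    = 0#
  tail w s (suc d) = C s (suc d) * w ^ s + tail w (suc s) d

  -- q n ^ n and q n ^ suc n are x^(j(j+1)/2) for j = 2n and j = 2n + 1.
  ψ : ℕ → Carrier
  ψ zero    = 0#
  ψ (suc n) = (ψ n + q n ^ n) + q n ^ suc n

  -- Both sides are `O (suc s)` times the product of `even k` over s ≤ k ≤ s + d.
  C-shift : ∀ s d → C s (suc d) * odd s ≈ C (suc s) d * even s
  C-shift s zero    = xy∙z≈xz∙y (O s) (even s) (odd s)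
  C-shift s (suc d) rewrite ℕ.+-suc d s = begin
    (C s (suc d) * e) * odd s   ≈⟨ xy∙z≈xz∙y (C s (suc d)) e (odd s) ⟩
    (C s (suc d) * odd s) * e   ≈⟨ *-congʳ (C-shift s d) ⟩
    (C (suc s) d * even s) * e  ≈⟨ xy∙z≈xz∙y (C (suc s) d) (even s) e ⟩
    (C (suc s) d * e) * even s  ∎
    where e = even (suc (d ℕ.+ s))

  C-zero : ∀ n → C 0 n ≡ E n
  C-zero zero    = ≡.refl
  C-zero (suc n) = ≡.cong₂ (λ c k → c * even k) (C-zero n) (ℕ.+-identityʳ n)

  -- The terms of the telescoping sum in the induction step from m to suc m.
  V : Carrier → ℕ → ℕ → Carrier
  V v s d = C s d * (1# + (x * x) ^ s) * v ^ s

  q-suc-^ : ∀ m s → q (suc m) ^ s ≈ (x * x) ^ s * q m ^ s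
  q-suc-^ m s = trans
    (^-congˡ s (solve 3 (λ a b c → a :* (b :* c) := b :* (a :* c)) refl x (x * x) ((x * x) ^ m)))
    (^-distrib-* (x * x) (q m) s)

  -- The summands of index `s` for `suc m` and `m` combine into two terms of the telescoping sum.
  -- For the second one this is visible after `C-shift`: `even s` is the factor
  -- `1# + (x * x) ^ suc s` of the next `V`.
  term : ∀ m s c → (c * even m) * q (suc m) ^ s + (1# + q m) * (c * q m ^ s) ≈
                   c * (1# + (x * x) ^ s) * q m ^ s + (c * odd s) * q m ^ suc s
  term m s c = trans (+-congʳ (*-congˡ (q-suc-^ m s)))
    (solve 5 (λ x c z y u →
      (c :* (con 1 :+ (x :* x) :* z)) :* (y :* u) :+ (con 1 :+ x :* z) :* (c :* u) :=
      c :* (con 1 :+ y) :* u :+ (c :* (con 1 :+ x :* y)) :* ((x :* z) :* u)) refl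
      x c ((x * x) ^ m) ((x * x) ^ s) (q m ^ s))

  -- Neighbouring indices share a `V`, which cancels with itself because 1 + 1 = 0. Only the `V` at
  -- the lower end and the boundary term from index `m` survive; `O m * q m ^ m` supplies the
  -- summand of index `m` that `tail (q m)` lacks.
  telescope : ∀ d s m → d ℕ.+ s ≡ m →
    tail (q (suc m)) s (suc d) + (1# + q m) * (tail (q m) s d + O m * q m ^ m) ≈
    V (q m) s d + O (suc m) * q m ^ suc m
  telescope zero s .s ≡.refl =
    trans (+-cong (+-identityʳ _) (*-congˡ (+-identityˡ _))) (term s s (O s))
  telescope (suc d) s m eq = begin
    (C s (suc d) * even (suc d ℕ.+ s) * q (suc m) ^ s + t₁) + r * ((C s (suc d) * q m ^ s + t₂) + o)
      ≡⟨ ≡.cong (λ k → (C s (suc d) * even k * q (suc m) ^ s + t₁) + r * ((C s (suc d) * q m ^ s + t₂) + o)) eq ⟩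
    (C s (suc d) * even m * q (suc m) ^ s + t₁) + r * ((C s (suc d) * q m ^ s + t₂) + o)
      ≈⟨ solve 6 (λ a t₁ r b t₂ o → (a :+ t₁) :+ r :* ((b :+ t₂) :+ o) :=
                                    (a :+ r :* b) :+ (t₁ :+ r :* (t₂ :+ o))) refl _ t₁ r _ t₂ o ⟩
    (C s (suc d) * even m * q (suc m) ^ s + r * (C s (suc d) * q m ^ s)) + (t₁ + r * (t₂ + o))
      ≈⟨ +-cong (term m s (C s (suc d))) (telescope d (suc s) m (≡.trans (ℕ.+-suc d s) eq)) ⟩
    (V (q m) s (suc d) + C s (suc d) * odd s * q m ^ suc s) + (v + o′)
      ≈⟨ +-congʳ (+-congˡ (*-congʳ (C-shift s d))) ⟩
    (V (q m) s (suc d) + v) + (v + o′)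
      ≈⟨ solve 3 (λ a b c → (a :+ b) :+ (b :+ c) := (a :+ c) :+ (b :+ b)) refl _ v o′ ⟩
    (V (q m) s (suc d) + o′) + (v + v)
      ≈⟨ trans (+-congˡ (a+a≈0 v)) (+-identityʳ _) ⟩
    V (q m) s (suc d) + o′ ∎
    where
    r = 1# + q m
    o = O m * q m ^ m
    o′ = O (suc m) * q m ^ suc m
    t₁ = tail (q (suc m)) (suc s) (suc d)
    t₂ = tail (q m) (suc s) d
    v = V (q m) (suc s) d

  -- By `telescope`, passing from `m` to `suc m` multiplies the tail by `odd m` and adds the two new
  -- terms of `ψ`.
  tail≈Oψ : ∀ n → tail (q n) 0 n ≈ O n * ψ n
  tail≈Oψ zero    = sym (zeroʳ 1#)
  tail≈Oψ (suc m) = begin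
    t                              ≈⟨ +-identityʳ t ⟨
    -- Adding `u` twice replaces subtraction: `telescope` evaluates `t + u`, and the second `u`
    -- carries the induction hypothesis.
    t + 0#                         ≈⟨ +-congˡ (a+a≈0 u) ⟨
    t + (u + u)                    ≈⟨ +-assoc t u u ⟨
    (t + u) + u                    ≈⟨ +-congʳ (telescope m 0 m (ℕ.+-identityʳ m)) ⟩
    (V (q m) 0 m + o′) + u         ≈⟨ +-congʳ (+-congʳ V≈0) ⟩
    (0# + o′) + u                  ≈⟨ +-cong (+-identityˡ o′) (*-congˡ (+-congʳ (tail≈Oψ m))) ⟩
    O m * odd m * p′ + (1# + q m) * (O m * ψ m + O m * p)
      ≈⟨ solve 5 (λ o q f p p′ → o :* (con 1 :+ q) :* p′ :+ (con 1 :+ q) :* (o :* f :+ o :* p) :=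
                                 o :* (con 1 :+ q) :* ((f :+ p) :+ p′)) refl (O m) (q m) (ψ m) p p′ ⟩
    O m * odd m * ((ψ m + p) + p′) ∎
    where
    p = q m ^ m
    p′ = q m ^ suc m
    t = tail (q (suc m)) 0 (suc m)
    u = (1# + q m) * (tail (q m) 0 m + O m * p)
    o′ = O (suc m) * p′
    -- At index 0 the factor `1# + (x * x) ^ 0` is 1 + 1.
    V≈0 : V (q m) 0 m ≈ 0#
    V≈0 = trans (*-congʳ (trans (*-congˡ 1+1≈0) (zeroʳ _))) (zeroˡ _)

  tail-divisible : ∀ w s d → ∃ λ z → tail w (suc s) d ≈ w * z
  tail-divisible w s zero    = 0# , sym (zeroʳ w)
  tail-divisible w s (suc d) = let z , eq = tail-divisible w (suc s) d in
    C (suc s) (suc d) * w ^ s + z ,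
    trans (+-congˡ eq) (solve 4 (λ c w p z → c :* (w :* p) :+ w :* z := w :* (c :* p :+ z))
      refl (C (suc s) (suc d)) w (w ^ s) z)

  -- The summand of index 0 in the tail is `E (suc m)`; all later ones contain a positive power of
  -- `q (suc m)`.
  Oψ≈E+ : ∀ m → ∃ λ z → O (suc m) * ψ (suc m) ≈ E (suc m) + q (suc m) * z
  Oψ≈E+ m = let z , eq = tail-divisible (q (suc m)) 0 m in
    z , trans (sym (tail≈Oψ (suc m)))
      (+-cong (trans (*-identityʳ _) (reflexive (C-zero (suc m)))) eq)

  -- Truncated denominator and numerator of the generating function of `b 4` modulo 2.
  F G : ℕ → Carrier
  F zero    = 1#
  F (suc k) = F k * (1# + x ^ suc k)
  G zero    = 1#
  G (suc n) = G n * (1# + x ^ (suc n ℕ.* 4))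

  x^2n : ∀ n → x ^ (n ℕ.* 2) ≈ (x * x) ^ n
  x^2n zero    = refl
  x^2n (suc n) = trans (sym (*-assoc x x _)) (*-congˡ (x^2n n))

  F≈OE : ∀ n → F (n ℕ.* 2) ≈ O n * E n
  F≈OE zero    = sym (*-identityˡ 1#)
  F≈OE (suc n) = begin
    F (n ℕ.* 2) * (1# + x * x ^ (n ℕ.* 2)) * (1# + x ^ (suc n ℕ.* 2))
      ≈⟨ *-cong (*-cong (F≈OE n) (+-congˡ (*-congˡ (x^2n n)))) (+-congˡ (x^2n (suc n))) ⟩
    O n * E n * odd n * even n
      ≈⟨ solve 4 (λ a b c d → a :* b :* c :* d := (a :* c) :* (b :* d)) refl (O n) (E n) (odd n) (even n) ⟩
    O n * odd n * (E n * even n) ∎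

  square-1+ : ∀ a → (1# + a) * (1# + a) ≈ 1# + a * a
  square-1+ a = begin
    (1# + a) * (1# + a)     ≈⟨ solve 1 (λ a → (con 1 :+ a) :* (con 1 :+ a) := (con 1 :+ a :* a) :+ (a :+ a)) refl a ⟩
    (1# + a * a) + (a + a)  ≈⟨ trans (+-congˡ (a+a≈0 a)) (+-identityʳ _) ⟩
    1# + a * a              ∎

  x^4n : ∀ n → x ^ (n ℕ.* 4) ≈ (x * x) ^ n * (x * x) ^ n
  x^4n zero    = sym (*-identityˡ 1#)
  x^4n (suc n) = trans (*-congˡ (*-congˡ (*-congˡ (*-congˡ (x^4n n)))))
    (solve 2 (λ x y → x :* (x :* (x :* (x :* (y :* y)))) := ((x :* x) :* y) :* ((x :* x) :* y)) refl x ((x * x) ^ n))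

  -- Squaring is additive in characteristic two, so each factor 1 + x^(2k) squares to 1 + x^(4k).
  E²≈G : ∀ n → E n * E n ≈ G n
  E²≈G zero    = *-identityˡ 1#
  E²≈G (suc n) = begin
    (E n * even n) * (E n * even n)  ≈⟨ interchange (E n) (even n) (E n) (even n) ⟩
    (E n * E n) * (even n * even n)  ≈⟨ *-cong (E²≈G n) (trans (square-1+ _) (+-congˡ (sym (x^4n (suc n))))) ⟩
    G (suc n) ∎

  -- This is `Oψ≈E+` multiplied by `E (suc m)`; the error starts only in degree 2(m + 1) + 1.
  Fψ≈G+ : ∀ m → ∃ λ z → F (suc m ℕ.* 2) * ψ (suc m) ≈ G (suc m) + x ^ suc (suc m ℕ.* 2) * z
  Fψ≈G+ m = let z , eq = Oψ≈E+ m; n = suc m in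
    z * E n , (begin
    F (n ℕ.* 2) * ψ n              ≈⟨ *-congʳ (F≈OE n) ⟩
    O n * E n * ψ n                ≈⟨ xy∙z≈xz∙y (O n) (E n) (ψ n) ⟩
    O n * ψ n * E n                ≈⟨ *-congʳ eq ⟩
    (E n + q n * z) * E n          ≈⟨ solve 3 (λ e q z → (e :+ q :* z) :* e := e :* e :+ q :* (z :* e)) refl (E n) (q n) z ⟩
    E n * E n + q n * (z * E n)    ≈⟨ +-cong (E²≈G n) (*-congʳ (*-congˡ (sym (x^2n n)))) ⟩
    G n + x ^ suc (n ℕ.* 2) * (z * E n) ∎)

-- Polynomials over the field of two elements acting on power series

open ≡ using (refl; sym; trans; cong; cong₂; subst; module ≡-Reasoning)

open CommutativeSemigroupProperties (CommutativeRing.+-commutativeSemigroup ℙ.+-*-commutativeRing)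
  using (interchange)

Series : Set
Series = ℕ → Parity

infixl 6 _⊕_
infixl 7 _⊗_

-- Only the action of polynomials on series matters, so they are taken as
-- expressions, equal when they act equally: the ring laws are then laws of
-- composition, and no convolution is needed.
data Poly : Set where
  𝟘 𝟙 X   : Poly
  _⊕_ _⊗_ : Poly → Poly → Poly

shift : Series → Series
shift f zero    = 0ℙ
shift f (suc n) = f n

⟦_⟧ : Poly → Series → Series
⟦ 𝟘 ⟧     f n = 0ℙ
⟦ 𝟙 ⟧     f   = f
⟦ X ⟧     f   = shift f
⟦ a ⊕ b ⟧ f n = ⟦ a ⟧ f n ⊞ ⟦ b ⟧ f n
⟦ a ⊗ b ⟧ f   = ⟦ a ⟧ (⟦ b ⟧ f)

infix 4 _≈[_]_

_≈[_]_ : Series → ℕ → Series → Set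
f ≈[ N ] g = ∀ n → n ≤ N → f n ≡ g n

⟦⟧-cong-≤ : ∀ a {f g N} → f ≈[ N ] g → ⟦ a ⟧ f ≈[ N ] ⟦ a ⟧ g
⟦⟧-cong-≤ 𝟘       eq n       n≤N = refl
⟦⟧-cong-≤ 𝟙       eq n       n≤N = eq n n≤N
⟦⟧-cong-≤ X       eq zero    n≤N = refl
⟦⟧-cong-≤ X       eq (suc n) n<N = eq n (ℕ.<⇒≤ n<N)
⟦⟧-cong-≤ (a ⊕ b) eq n       n≤N = cong₂ _⊞_ (⟦⟧-cong-≤ a eq n n≤N) (⟦⟧-cong-≤ b eq n n≤N)
⟦⟧-cong-≤ (a ⊗ b) eq         = ⟦⟧-cong-≤ a (⟦⟧-cong-≤ b eq)

⟦⟧-cong : ∀ a {f g} → f ≗ g → ⟦ a ⟧ f ≗ ⟦ a ⟧ g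
⟦⟧-cong a eq n = ⟦⟧-cong-≤ a (λ k _ → eq k) n ℕ.≤-refl

⟦⟧-zero : ∀ a n → ⟦ a ⟧ (λ _ → 0ℙ) n ≡ 0ℙ
⟦⟧-zero 𝟘       n       = refl
⟦⟧-zero 𝟙       n       = refl
⟦⟧-zero X       zero    = refl
⟦⟧-zero X       (suc n) = refl
⟦⟧-zero (a ⊕ b) n       = cong₂ _⊞_ (⟦⟧-zero a n) (⟦⟧-zero b n)
⟦⟧-zero (a ⊗ b) n       = trans (⟦⟧-cong a (⟦⟧-zero b) n) (⟦⟧-zero a n)

⟦⟧-+ : ∀ a f g n → ⟦ a ⟧ (λ k → f k ⊞ g k) n ≡ ⟦ a ⟧ f n ⊞ ⟦ a ⟧ g n
⟦⟧-+ 𝟘       f g n       = refl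
⟦⟧-+ 𝟙       f g n       = refl
⟦⟧-+ X       f g zero    = refl
⟦⟧-+ X       f g (suc n) = refl
⟦⟧-+ (a ⊕ b) f g n       = trans (cong₂ _⊞_ (⟦⟧-+ a f g n) (⟦⟧-+ b f g n))
  (interchange (⟦ a ⟧ f n) (⟦ a ⟧ g n) (⟦ b ⟧ f n) (⟦ b ⟧ g n))
⟦⟧-+ (a ⊗ b) f g n       = trans (⟦⟧-cong a (⟦⟧-+ b f g) n) (⟦⟧-+ a (⟦ b ⟧ f) (⟦ b ⟧ g) n)

⟦⟧-shift : ∀ a f → ⟦ a ⟧ (shift f) ≗ shift (⟦ a ⟧ f)
⟦⟧-shift 𝟘       f zero    = refl
⟦⟧-shift 𝟘       f (suc n) = refl
⟦⟧-shift 𝟙       f n       = refl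
⟦⟧-shift X       f n       = refl
⟦⟧-shift (a ⊕ b) f zero    = cong₂ _⊞_ (⟦⟧-shift a f zero) (⟦⟧-shift b f zero)
⟦⟧-shift (a ⊕ b) f (suc n) = cong₂ _⊞_ (⟦⟧-shift a f (suc n)) (⟦⟧-shift b f (suc n))
⟦⟧-shift (a ⊗ b) f n       = trans (⟦⟧-cong a (⟦⟧-shift b f) n) (⟦⟧-shift a (⟦ b ⟧ f) n)

-- Multiplication is composition, so commutativity is not definitional. It rests on every action
-- being additive, preserving zero and commuting with `shift`.
⟦⟧-comm : ∀ a b f → ⟦ a ⟧ (⟦ b ⟧ f) ≗ ⟦ b ⟧ (⟦ a ⟧ f)
⟦⟧-comm 𝟘       b f n = sym (⟦⟧-zero b n)
⟦⟧-comm 𝟙       b f n = refl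
⟦⟧-comm X       b f n = sym (⟦⟧-shift b f n)
⟦⟧-comm (a ⊕ c) b f n = trans (cong₂ _⊞_ (⟦⟧-comm a b f n) (⟦⟧-comm c b f n))
  (sym (⟦⟧-+ b (⟦ a ⟧ f) (⟦ c ⟧ f) n))
⟦⟧-comm (a ⊗ c) b f n = trans (⟦⟧-cong a (⟦⟧-comm c b f) n) (⟦⟧-comm a b (⟦ c ⟧ f) n)

infix 4 _≈ᵖ_

_≈ᵖ_ : Poly → Poly → Set
a ≈ᵖ b = ∀ f → ⟦ a ⟧ f ≗ ⟦ b ⟧ f

≈ᵖ-isEquivalence : IsEquivalence _≈ᵖ_
≈ᵖ-isEquivalence = record
  { refl  = λ f n → refl
  ; sym   = λ p f n → sym (p f n)
  ; trans = λ p q f n → trans (p f n) (q f n)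
  }

polySemiring : CommutativeSemiring 0ℓ 0ℓ
polySemiring = record
  { Carrier = Poly
  ; _≈_ = _≈ᵖ_
  ; _+_ = _⊕_
  ; _*_ = _⊗_
  ; 0# = 𝟘
  ; 1# = 𝟙
  ; isCommutativeSemiring = isCommutativeSemiringˡ record
    { +-isCommutativeMonoid = record
      { isMonoid = record
        { isSemigroup = record
          { isMagma = record
            { isEquivalence = ≈ᵖ-isEquivalence
            ; ∙-cong = λ p q f n → cong₂ _⊞_ (p f n) (q f n) }
          ; assoc = λ a b c f n → ℙ.+-assoc (⟦ a ⟧ f n) (⟦ b ⟧ f n) (⟦ c ⟧ f n) }
        ; identity = (λ a f n → refl) , (λ a f n → ℙ.+-identityʳ (⟦ a ⟧ f n)) }
      ; comm = λ a b f n → ℙ.+-comm (⟦ a ⟧ f n) (⟦ b ⟧ f n) }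
    ; *-isCommutativeMonoid = record
      { isMonoid = record
        { isSemigroup = record
          { isMagma = record
            { isEquivalence = ≈ᵖ-isEquivalence
            ; ∙-cong = λ {a} {b} {c} p q f n → trans (⟦⟧-cong a (q f) n) (p _ n) }
          ; assoc = λ a b c f n → refl }
        ; identity = (λ a f n → refl) , (λ a f n → refl) }
      ; comm = ⟦⟧-comm }
    ; distribʳ = λ a b c f n → refl
    ; zeroˡ = λ a f n → refl
    }
  }

open CommutativeSemiringExp polySemiring using ()
  renaming (_^_ to _^ᵖ_; ^-congˡ to ^ᵖ-congˡ; ^-assocʳ to ^ᵖ-assocʳ)
open Shanks polySemiring (λ f n → ℙ.p+p≡0ℙ (f n)) X using (F; G; ψ; q; Fψ≈G+; x^2n)

⟦X^⟧-< : ∀ k f n → n < k → ⟦ X ^ᵖ k ⟧ f n ≡ 0ℙ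
⟦X^⟧-< (suc k) f zero    _   = refl
⟦X^⟧-< (suc k) f (suc n) n<k = ⟦X^⟧-< k f n (s≤s⁻¹ n<k)

⟦X^⟧-≥ : ∀ k f n → k ≤ n → ⟦ X ^ᵖ k ⟧ f n ≡ f (n ℕ.∸ k)
⟦X^⟧-≥ zero    f n       _   = refl
⟦X^⟧-≥ (suc k) f (suc n) k≤n = ⟦X^⟧-≥ k f n (s≤s⁻¹ k≤n)

-- The power series 1, so that `⟦ a ⟧ δ` lists the coefficients of `a`.
δ : Series
δ zero    = 1ℙ
δ (suc _) = 0ℙ

⟦X^⟧δ-≢ : ∀ k n → k ≢ n → ⟦ X ^ᵖ k ⟧ δ n ≡ 0ℙ
⟦X^⟧δ-≢ zero    zero    k≢n = contradiction refl k≢n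
⟦X^⟧δ-≢ zero    (suc n) k≢n = refl
⟦X^⟧δ-≢ (suc k) zero    k≢n = refl
⟦X^⟧δ-≢ (suc k) (suc n) k≢n = ⟦X^⟧δ-≢ k n (λ eq → k≢n (cong suc eq))

q^≈X^ : ∀ n j f → ⟦ q n ^ᵖ j ⟧ f ≗ ⟦ X ^ᵖ (suc (n ℕ.* 2) ℕ.* j) ⟧ f
q^≈X^ n j f k = trans (^ᵖ-congˡ j {q n} {X ^ᵖ suc (n ℕ.* 2)} q≈X^ f k) (^ᵖ-assocʳ X (suc (n ℕ.* 2)) j f k)
  where
  q≈X^ : ∀ f → ⟦ q n ⟧ f ≗ ⟦ X ^ᵖ suc (n ℕ.* 2) ⟧ f
  q≈X^ f k = ⟦⟧-cong X (λ m → sym (x^2n n f m)) k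

-- The exponents T in `ψ` are triangular: 8T + 1 is (4n + 1)² or (4n + 3)².
ψ-nonsquare : ∀ n {N} → (∀ y → y ℕ.* y ≢ suc (8 ℕ.* N)) → ⟦ ψ n ⟧ δ N ≡ 0ℙ
ψ-nonsquare zero    nonsq = refl
ψ-nonsquare (suc n) {N} nonsq = cong₂ _⊞_ (cong₂ _⊞_ (ψ-nonsquare n nonsq)
  (trans (q^≈X^ n n δ N) (⟦X^⟧δ-≢ (suc (n ℕ.* 2) ℕ.* n) N λ { refl → nonsq (4 ℕ.* n ℕ.+ 1) (eq₁ n) })))
  (trans (q^≈X^ n (suc n) δ N) (⟦X^⟧δ-≢ (suc (n ℕ.* 2) ℕ.* suc n) N λ { refl → nonsq (4 ℕ.* n ℕ.+ 3) (eq₂ n) }))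
  where
  eq₁ : ∀ n → (4 ℕ.* n ℕ.+ 1) ℕ.* (4 ℕ.* n ℕ.+ 1) ≡ suc (8 ℕ.* (suc (n ℕ.* 2) ℕ.* n))
  eq₁ = solve-∀
  eq₂ : ∀ n → (4 ℕ.* n ℕ.+ 3) ℕ.* (4 ℕ.* n ℕ.+ 3) ≡ suc (8 ℕ.* (suc (n ℕ.* 2) ℕ.* suc n))
  eq₂ = solve-∀

-- The factor has constant term 1, so each coefficient of `f` is determined by the image and the
-- lower coefficients; hence the strong induction in `below`.
1+X^-cancel : ∀ k {f g N} → ⟦ 𝟙 ⊕ X ^ᵖ suc k ⟧ f ≈[ N ] ⟦ 𝟙 ⊕ X ^ᵖ suc k ⟧ g → f ≈[ N ] g
1+X^-cancel k {f} {g} {N} eq = below N ℕ.≤-refl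
  where
  below : ∀ n → n ≤ N → f ≈[ n ] g
  below zero    _   zero    _   = trans (sym (ℙ.+-identityʳ (f 0))) (trans (eq 0 z≤n) (ℙ.+-identityʳ (g 0)))
  below (suc n) n<N k′ k′≤1+n with ℕ.m≤n⇒m<n∨m≡n k′≤1+n
  ... | inj₁ k′<1+n = below n (ℕ.<⇒≤ n<N) k′ (s≤s⁻¹ k′<1+n)
  ... | inj₂ refl   = ℙ.+-cancelʳ-≡ (⟦ X ^ᵖ k ⟧ g n) (f (suc n)) (g (suc n))
    (trans (cong (f (suc n) ⊞_) (sym (⟦⟧-cong-≤ (X ^ᵖ k) (below n (ℕ.<⇒≤ n<N)) n ℕ.≤-refl))) (eq (suc n) n<N))

F-cancel : ∀ m {f g N} → ⟦ F m ⟧ f ≈[ N ] ⟦ F m ⟧ g → f ≈[ N ] g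
F-cancel zero    eq = eq
F-cancel (suc m) eq = 1+X^-cancel m (F-cancel m eq)

1+X^-trunc : ∀ {k N} → N < k → ∀ f → ⟦ 𝟙 ⊕ X ^ᵖ k ⟧ f ≈[ N ] f
1+X^-trunc {k} N<k f n n≤N =
  trans (cong (f n ⊞_) (⟦X^⟧-< k f n (ℕ.≤-<-trans n≤N N<k))) (ℙ.+-identityʳ (f n))

-- The extra factors are 1 + X^k with k > N, which leave degrees up to N alone.
F-trunc : ∀ j m {N} → N ≤ m → ∀ f → ⟦ F (j ℕ.+ m) ⟧ f ≈[ N ] ⟦ F m ⟧ f
F-trunc zero    m N≤m f n n≤N = refl
F-trunc (suc j) m N≤m f n n≤N = trans
  (⟦⟧-cong-≤ (F (j ℕ.+ m)) (1+X^-trunc (s≤s (ℕ.≤-trans N≤m (ℕ.m≤n+m m j))) f) n n≤N)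
  (F-trunc j m N≤m f n n≤N)

-- The generating function of regular partitions modulo 2

mutual
  -- Removing a part lowers the total faster than the fuel, whereas the series `B` below takes the
  -- total itself as fuel.
  partitions≤-fuel : ∀ f f′ m n → n ≤ f → n ≤ f′ → partitions≤ f m n ≡ partitions≤ f′ m n
  partitions≤-fuel f       f′       m       zero    _   _    = refl
  partitions≤-fuel f       f′       zero    (suc n) _   _    = refl
  partitions≤-fuel (suc f) (suc f′) (suc m) (suc n) n<f n<f′ = cong₂ _++_
    (partitions≤-fuel (suc f) (suc f′) m (suc n) n<f n<f′)
    (withPart-fuel f f′ m n (s≤s⁻¹ n<f) (s≤s⁻¹ n<f′))

  withPart-fuel : ∀ f f′ m n → n ≤ f → n ≤ f′ → withPart f m n ≡ withPart f′ m n
  withPart-fuel f f′ m n n≤f n≤f′ with m ℕ.≤? n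
  ... | yes _ = cong (map (suc m ∷_)) (partitions≤-fuel f f′ (suc m) (n ℕ.∸ m)
    (ℕ.≤-trans (ℕ.m∸n≤m n m) n≤f) (ℕ.≤-trans (ℕ.m∸n≤m n m) n≤f′))
  ... | no  _ = refl

#regular : ℕ → List (List ℕ) → ℕ
#regular ℓ xss = length (filter (regular? ℓ) xss)

#regular-++ : ∀ ℓ xss yss → #regular ℓ (xss ++ yss) ≡ #regular ℓ xss ℕ.+ #regular ℓ yss
#regular-++ ℓ xss yss = trans (cong length (filter-++ (regular? ℓ) xss yss)) (length-++ (filter (regular? ℓ) xss))

#regular-∤ : ∀ {ℓ k} → ¬ (ℓ ∣ k) → ∀ xss → #regular ℓ (map (k ∷_) xss) ≡ #regular ℓ xss
#regular-∤ ℓ∤k [] = refl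
#regular-∤ {ℓ} {k} ℓ∤k (xs ∷ xss) with ℓ ∣? k | regular? ℓ xs
... | yes ℓ∣k | _     = contradiction ℓ∣k ℓ∤k
... | no  _   | yes _ = cong suc (#regular-∤ ℓ∤k xss)
... | no  _   | no  _ = #regular-∤ ℓ∤k xss

#regular-∣ : ∀ {ℓ k} → ℓ ∣ k → ∀ xss → #regular ℓ (map (k ∷_) xss) ≡ 0
#regular-∣ ℓ∣k [] = refl
#regular-∣ {ℓ} {k} ℓ∣k (xs ∷ xss) with ℓ ∣? k
... | yes _   = #regular-∣ ℓ∣k xss
... | no  ℓ∤k = contradiction ℓ∣k ℓ∤k

-- Coefficients of ∏ 1/(1 + X^k) over the k ≤ m not divisible by ℓ.
B : ℕ → ℕ → Series
B ℓ m n = parity (#regular ℓ (partitions≤ n m n))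

B-suc : ∀ ℓ m n → B ℓ (suc m) (suc n) ≡ B ℓ m (suc n) ⊞ parity (#regular ℓ (withPart n m n))
B-suc ℓ m n = trans (cong parity (#regular-++ ℓ (partitions≤ (suc n) m (suc n)) (withPart n m n)))
  (ℙ.+-homo-+ (#regular ℓ (partitions≤ (suc n) m (suc n))) _)

B-suc-∣ : ∀ {ℓ} m → ℓ ∣ suc m → B ℓ (suc m) ≗ B ℓ m
B-suc-∣     m ℓ∣ zero    = refl
B-suc-∣ {ℓ} m ℓ∣ (suc n) = trans (B-suc ℓ m n)
  (trans (cong (B ℓ m (suc n) ⊞_) none) (ℙ.+-identityʳ _))
  where
  none : parity (#regular ℓ (withPart n m n)) ≡ 0ℙ
  none with m ℕ.≤? n
  ... | yes _ = cong parity (#regular-∣ ℓ∣ (partitions≤ n (suc m) (n ℕ.∸ m)))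
  ... | no  _ = refl

-- Removing one part `suc m` turns the partitions that contain it into those counted by the shifted
-- series. Modulo 2, adding that series again cancels them.
B-suc-∤ : ∀ {ℓ} m → ¬ (ℓ ∣ suc m) → ⟦ 𝟙 ⊕ X ^ᵖ suc m ⟧ (B ℓ (suc m)) ≗ B ℓ m
B-suc-∤     m ℓ∤ zero    = refl
B-suc-∤ {ℓ} m ℓ∤ (suc n) = begin
  B ℓ (suc m) (suc n) ⊞ ⟦ X ^ᵖ m ⟧ (B ℓ (suc m)) n
    ≡⟨ cong (_⊞ s) (trans (B-suc ℓ m n) (cong (B ℓ m (suc n) ⊞_) withPart≡)) ⟩
  (B ℓ m (suc n) ⊞ s) ⊞ s
    ≡⟨ ℙ.+-assoc (B ℓ m (suc n)) s s ⟩
  B ℓ m (suc n) ⊞ (s ⊞ s)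
    ≡⟨ cong (B ℓ m (suc n) ⊞_) (ℙ.p+p≡0ℙ s) ⟩
  B ℓ m (suc n) ⊞ 0ℙ
    ≡⟨ ℙ.+-identityʳ _ ⟩
  B ℓ m (suc n) ∎
  where
  open ≡-Reasoning
  s = ⟦ X ^ᵖ m ⟧ (B ℓ (suc m)) n
  withPart≡ : parity (#regular ℓ (withPart n m n)) ≡ s
  withPart≡ with m ℕ.≤? n
  ... | yes m≤n = trans
    (cong parity (trans (#regular-∤ ℓ∤ (partitions≤ n (suc m) (n ℕ.∸ m)))
      (cong (#regular ℓ) (partitions≤-fuel n (n ℕ.∸ m) (suc m) (n ℕ.∸ m) (ℕ.m∸n≤m n m) ℕ.≤-refl))))
    (sym (⟦X^⟧-≥ m (B ℓ (suc m)) n m≤n))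
  ... | no  m≰n = sym (⟦X^⟧-< m (B ℓ (suc m)) n (ℕ.≰⇒> m≰n))

B-suc-≥ : ∀ ℓ m n → n ≤ m → B ℓ (suc m) n ≡ B ℓ m n
B-suc-≥ ℓ m zero    _   = refl
B-suc-≥ ℓ m (suc n) n<m = trans (B-suc ℓ m n)
  (trans (cong (B ℓ m (suc n) ⊞_) none) (ℙ.+-identityʳ _))
  where
  none : parity (#regular ℓ (withPart n m n)) ≡ 0ℙ
  none with m ℕ.≤? n
  ... | yes m≤n = contradiction m≤n (ℕ.<⇒≱ n<m)
  ... | no  _   = refl

B-stable : ∀ ℓ j n → B ℓ (j ℕ.+ n) n ≡ B ℓ n n
B-stable ℓ zero    n = refl
B-stable ℓ (suc j) n = trans (B-suc-≥ ℓ (j ℕ.+ n) n (ℕ.m≤n+m n j)) (B-stable ℓ j n)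

B-zero : ∀ ℓ → B ℓ 0 ≗ δ
B-zero ℓ zero    = refl
B-zero ℓ (suc n) = refl

-- Each step treats four consecutive bounds. The three factors whose exponent is not a multiple of 4
-- are absorbed by `B`; the fourth does not affect `B` and becomes the next factor of `G`.
F*B≗G : ∀ k → ⟦ F (k ℕ.* 4) ⟧ (B 4 (k ℕ.* 4)) ≗ ⟦ G k ⟧ δ
F*B≗G zero    = B-zero 4
F*B≗G (suc k) n = begin
  ⟦ F m ⊗ M 1 ⊗ M 2 ⊗ M 3 ⊗ M 4 ⟧ (B 4 (4 ℕ.+ m)) n
    -- The rightmost factor acts first, so `M 4` moves to the front to let `M 3`, `M 2`, `M 1` meet
    -- `B` in turn.
    ≡⟨ ⟦⟧-comm (F m ⊗ M 1 ⊗ M 2 ⊗ M 3) (M 4) (B 4 (4 ℕ.+ m)) n ⟩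
  ⟦ M 4 ⊗ (F m ⊗ M 1 ⊗ M 2 ⊗ M 3) ⟧ (B 4 (4 ℕ.+ m)) n
    ≡⟨ ⟦⟧-cong (M 4 ⊗ (F m ⊗ M 1 ⊗ M 2 ⊗ M 3)) (B-suc-∣ (3 ℕ.+ m) (n∣m*n (suc k))) n ⟩
  ⟦ M 4 ⊗ (F m ⊗ M 1 ⊗ M 2 ⊗ M 3) ⟧ (B 4 (3 ℕ.+ m)) n
    ≡⟨ ⟦⟧-cong (M 4 ⊗ (F m ⊗ M 1 ⊗ M 2)) (B-suc-∤ (2 ℕ.+ m) (4∤ 3 (from-no (4 ∣? 3)))) n ⟩
  ⟦ M 4 ⊗ (F m ⊗ M 1 ⊗ M 2) ⟧ (B 4 (2 ℕ.+ m)) n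
    ≡⟨ ⟦⟧-cong (M 4 ⊗ (F m ⊗ M 1)) (B-suc-∤ (1 ℕ.+ m) (4∤ 2 (from-no (4 ∣? 2)))) n ⟩
  ⟦ M 4 ⊗ (F m ⊗ M 1) ⟧ (B 4 (1 ℕ.+ m)) n
    ≡⟨ ⟦⟧-cong (M 4 ⊗ F m) (B-suc-∤ m (4∤ 1 (from-no (4 ∣? 1)))) n ⟩
  ⟦ M 4 ⊗ F m ⟧ (B 4 m) n
    ≡⟨ ⟦⟧-cong (M 4) (F*B≗G k) n ⟩
  ⟦ M 4 ⊗ G k ⟧ δ n
    ≡⟨ ⟦⟧-comm (M 4) (G k) δ n ⟩
  ⟦ G (suc k) ⟧ δ n ∎
  where
  open ≡-Reasoning
  m = k ℕ.* 4
  M : ℕ → Poly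
  M i = 𝟙 ⊕ X ^ᵖ (i ℕ.+ m)
  4∤ : ∀ i → ¬ (4 ∣ i) → ¬ (4 ∣ i ℕ.+ m)
  4∤ i 4∤i 4∣i+m = 4∤i (∣m+n∣m⇒∣n (subst (4 ∣_) (ℕ.+-comm i m) 4∣i+m) (n∣m*n k))

-- Gauss's identity and the parity of `b 4`

-- In degrees up to `N`, multiplication by `F (n * 4)` turns both series into `G n`, and this factor
-- can be cancelled. The left side is the parity of `b 4 N` by definition.
B≈ψ : ∀ N → B 4 N N ≡ ⟦ ψ (suc N) ⟧ δ N
B≈ψ N = trans (sym stable) (F-cancel (n ℕ.* 4) {B 4 (n ℕ.* 4)} {⟦ ψ n ⟧ δ} FB≈Fψ N ℕ.≤-refl)
  where
  open ≡-Reasoning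
  n = suc N
  N≤n*2 : N ≤ n ℕ.* 2
  N≤n*2 = ℕ.≤-trans (ℕ.n≤1+n N) (ℕ.m≤m*n n 2)
  stable : B 4 (n ℕ.* 4) N ≡ B 4 N N
  stable = trans (cong (λ m → B 4 m N) (eq N)) (B-stable 4 (4 ℕ.+ N ℕ.* 3) N)
    where
    eq : ∀ N → suc N ℕ.* 4 ≡ (4 ℕ.+ N ℕ.* 3) ℕ.+ N
    eq = solve-∀
  FB≈Fψ : ⟦ F (n ℕ.* 4) ⟧ (B 4 (n ℕ.* 4)) ≈[ N ] ⟦ F (n ℕ.* 4) ⟧ (⟦ ψ n ⟧ δ)
  FB≈Fψ k k≤N = begin
    ⟦ F (n ℕ.* 4) ⟧ (B 4 (n ℕ.* 4)) k             ≡⟨ F*B≗G n k ⟩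
    ⟦ G n ⟧ δ k                                   ≡⟨ ℙ.+-identityʳ _ ⟨
    ⟦ G n ⟧ δ k ⊞ 0ℙ                              ≡⟨ cong (⟦ G n ⟧ δ k ⊞_) Xz≡0 ⟨
    ⟦ G n ⊕ X ^ᵖ suc (n ℕ.* 2) ⊗ z ⟧ δ k          ≡⟨ proj₂ (Fψ≈G+ N) δ k ⟨
    ⟦ F (n ℕ.* 2) ⟧ (⟦ ψ n ⟧ δ) k                 ≡⟨ F-trunc (n ℕ.* 2) (n ℕ.* 2) N≤n*2 (⟦ ψ n ⟧ δ) k k≤N ⟨
    ⟦ F (n ℕ.* 2 ℕ.+ n ℕ.* 2) ⟧ (⟦ ψ n ⟧ δ) k     ≡⟨ cong (λ m → ⟦ F m ⟧ (⟦ ψ n ⟧ δ) k) (ℕ.*-distribˡ-+ n 2 2) ⟨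
    ⟦ F (n ℕ.* 4) ⟧ (⟦ ψ n ⟧ δ) k                 ∎
    where
    z = proj₁ (Fψ≈G+ N)
    -- The error term of `Fψ≈G+` begins in degree 2n + 1, beyond `N`.
    Xz≡0 : ⟦ X ^ᵖ suc (n ℕ.* 2) ⊗ z ⟧ δ k ≡ 0ℙ
    Xz≡0 = ⟦X^⟧-< (suc (n ℕ.* 2)) (⟦ z ⟧ δ) k (s≤s (ℕ.≤-trans k≤N N≤n*2))

parity≡0⇒2∣ : ∀ n → parity n ≡ 0ℙ → 2 ∣ n
parity≡0⇒2∣ zero          _  = divides 0 refl
parity≡0⇒2∣ (suc (suc n)) eq with parity≡0⇒2∣ n eq
... | divides k refl = divides (suc k) refl

b₄-even : ∀ N → (∀ y → y ℕ.* y ≢ suc (8 ℕ.* N)) → 2 ∣ b 4 N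
b₄-even N nonsq = parity≡0⇒2∣ (b 4 N) (trans (B≈ψ N) (ψ-nonsquare (suc N) nonsq))

-- Why 8N + 1 is not a square

open import Data.Nat using (_+_; _*_; _∸_; _^_)

¬2∣⇒odd : ∀ n → ¬ (2 ∣ n) → ∃ λ h → n ≡ suc (2 * h)
¬2∣⇒odd zero          2∤n = contradiction (2 ∣0) 2∤n
¬2∣⇒odd (suc zero)    2∤n = 0 , refl
¬2∣⇒odd (suc (suc n)) 2∤n with ¬2∣⇒odd n (λ 2∣n → 2∤n (∣m∣n⇒∣m+n ∣-refl 2∣n))
... | h , refl = suc h , eq h
  where
  eq : ∀ h → suc (suc (suc (2 * h))) ≡ suc (2 * suc h)
  eq = solve-∀

-- The squares of 2h + 1 and 2h + 3 differ by 8(h + 1).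
odd²≡1[8] : ∀ h → ∃ λ t → suc (2 * h) ^ 2 ≡ suc (8 * t)
odd²≡1[8] zero    = 0 , refl
odd²≡1[8] (suc h) with odd²≡1[8] h
... | t , eq = t + suc h , trans (eq₁ h) (trans (cong (_+ 8 * suc h) eq) (eq₂ t h))
  where
  -- Squares are unfolded here and below: solve-∀ fails on _^ 2.
  eq₁ : ∀ h → suc (2 * suc h) * (suc (2 * suc h) * 1) ≡ suc (2 * h) * (suc (2 * h) * 1) + 8 * suc h
  eq₁ = solve-∀
  eq₂ : ∀ t h → suc (8 * t) + 8 * suc h ≡ suc (8 * (t + suc h))
  eq₂ = solve-∀

^≡1[8] : ∀ m → (∃ λ t → m ≡ suc (8 * t)) → ∀ a → ∃ λ u → m ^ a ≡ suc (8 * u)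
^≡1[8] m m≡1 zero = 0 , refl
^≡1[8] m m≡1@(t , eq) (suc a) with ^≡1[8] m m≡1 a
... | u , eq′ = t + u + 8 * t * u , trans (cong₂ _*_ eq eq′) (eq″ t u)
  where
  eq″ : ∀ t u → suc (8 * t) * suc (8 * u) ≡ suc (8 * (t + u + 8 * t * u))
  eq″ = solve-∀

-- Descent on `a`: `p` divides `y`, and cancelling p² lowers `a` by one. At `a` = 0, cancelling a
-- single `p` makes `p` divide `w`.
odd-valuation-nonsquare : ∀ {p} → Prime p → ∀ a y w → ¬ (p ∣ w) → y * y ≢ p * (p ^ 2) ^ a * w
odd-valuation-nonsquare {p} pp a y w p∤w eq
  with [ id , id ]′ (euclidsLemma y y pp (subst (p ∣_) (sym eq) (∣m⇒∣m*n w (m∣m*n ((p ^ 2) ^ a)))))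
... | divides k refl = go a eq
  where
  instance
    p≢0 : NonZero p
    p≢0 = prime⇒nonZero pp
    p²≢0 : NonZero (p ^ 2)
    p²≢0 = ℕ.m^n≢0 p 2

  go : ∀ a → k * p * (k * p) ≢ p * (p ^ 2) ^ a * w
  go zero    eq = p∤w (divides (k * k) (ℕ.*-cancelˡ-≡ w (k * k * p) p
    (trans (cong (_* w) (sym (ℕ.*-identityʳ p))) (trans (sym eq) (eq₁ k p)))))
    where
    eq₁ : ∀ k p → k * p * (k * p) ≡ p * (k * k * p)
    eq₁ = solve-∀
  go (suc a) eq = odd-valuation-nonsquare pp a k w p∤w (ℕ.*-cancelˡ-≡ (k * k) (p * (p ^ 2) ^ a * w) (p ^ 2)
    (trans (eq₁ k p) (trans eq (eq₂ p ((p ^ 2) ^ a) w))))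
    where
    eq₁ : ∀ k p → p * (p * 1) * (k * k) ≡ k * p * (k * p)
    eq₁ = solve-∀
    eq₂ : ∀ p r w → p * (p * (p * 1) * r) * w ≡ p * (p * 1) * (p * r * w)
    eq₂ = solve-∀

odd-prime∤8 : ∀ {p} → Prime p → ¬ (2 ∣ p) → ¬ (p ∣ 8)
odd-prime∤8 {p} pp 2∤p p∣8 with [ id , [ id , id ]′ ∘ euclidsLemma 2 2 pp ]′ (euclidsLemma 2 4 pp p∣8)
... | p∣2 with prime⇒irreducible prime[2] p∣2
...   | inj₁ refl = contradiction pp ¬prime[1]
...   | inj₂ refl = 2∤p ∣-refl

theorem3p10 : (p : ℕ) → Prime p → ¬ (2 ∣ p) →
    (α : ℕ) → 1 ≤ α → (n : ℕ) →
    (i : ℕ) → 1 ≤ i → i ≤ p ∸ 1 →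
    2 ∣ b 4 (p ^ (2 * α) * n + ((8 * i + p) * p ^ (2 * α ∸ 1) ∸ 1) / 8)
theorem3p10 p pp 2∤p (suc a) 1≤α n i@(suc i′) 1≤i i≤p-1 =
  subst (λ N → 2 ∣ b 4 N) (sym N≡) (b₄-even N λ y eq →
    odd-valuation-nonsquare pp a y (8 * (p * n + i) + p) p∤w (trans eq 8N+1≡))
  where
  open ≡-Reasoning
  r u v N : ℕ
  -- With α = a + 1, `r` is p^(2α-2) and `p * r` is p^(2α-1).
  r = (p ^ 2) ^ a
  p²≡1 : ∃ λ t → p ^ 2 ≡ suc (8 * t)
  p²≡1 = let h , eq = ¬2∣⇒odd p 2∤p; t , eq′ = odd²≡1[8] h in t , trans (cong (_^ 2) eq) eq′
  u = proj₁ (^≡1[8] (p ^ 2) p²≡1 (suc a))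
  v = i * (p * r) + u
  N = p ^ 2 * r * n + v

  p²r≡ : p ^ 2 * r ≡ suc (8 * u)
  p²r≡ = proj₂ (^≡1[8] (p ^ 2) p²≡1 (suc a))

  p^2α∸1≡ : p ^ (2 * suc a ∸ 1) ≡ p * r
  p^2α∸1≡ = trans (cong (p ^_) (ℕ.+-suc a (a + 0))) (cong (p *_) (sym (ℕ.^-*-assoc p 2 a)))

  -- The division by 8 is exact because p^(2α) = 8u + 1, as p² is 1 modulo 8; its quotient is `v`.
  numerator≡ : (8 * i + p) * (p * r) ≡ suc (8 * (i * (p * r) + u))
  numerator≡ = begin
    (8 * i + p) * (p * r)            ≡⟨ eq₁ i p r ⟩
    8 * (i * (p * r)) + p ^ 2 * r    ≡⟨ cong (8 * (i * (p * r)) +_) p²r≡ ⟩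
    8 * (i * (p * r)) + suc (8 * u)  ≡⟨ eq₂ (i * (p * r)) u ⟩
    suc (8 * (i * (p * r) + u))      ∎
    where
    eq₁ : ∀ i p r → (8 * i + p) * (p * r) ≡ 8 * (i * (p * r)) + p * (p * 1) * r
    eq₁ = solve-∀
    eq₂ : ∀ v u → 8 * v + suc (8 * u) ≡ suc (8 * (v + u))
    eq₂ = solve-∀

  N≡ : p ^ (2 * suc a) * n + ((8 * i + p) * p ^ (2 * suc a ∸ 1) ∸ 1) / 8 ≡ N
  N≡ = cong₂ _+_ (cong (_* n) (sym (ℕ.^-*-assoc p 2 (suc a)))) (begin
    ((8 * i + p) * p ^ (2 * suc a ∸ 1) ∸ 1) / 8  ≡⟨ cong (λ k → ((8 * i + p) * k ∸ 1) / 8) p^2α∸1≡ ⟩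
    ((8 * i + p) * (p * r) ∸ 1) / 8              ≡⟨ cong (λ k → (k ∸ 1) / 8) numerator≡ ⟩
    8 * (i * (p * r) + u) / 8                    ≡⟨ trans (cong (_/ 8) (ℕ.*-comm 8 v)) (m*n/n≡m v 8) ⟩
    i * (p * r) + u                              ∎)

  8N+1≡ : suc (8 * N) ≡ p * r * (8 * (p * n + i) + p)
  8N+1≡ = begin
    suc (8 * (p ^ 2 * r * n + (i * (p * r) + u)))        ≡⟨ eq₁ (p ^ 2 * r * n) (i * (p * r) + u) ⟩
    8 * (p ^ 2 * r * n) + suc (8 * (i * (p * r) + u))    ≡⟨ cong (8 * (p ^ 2 * r * n) +_) numerator≡ ⟨
    8 * (p ^ 2 * r * n) + (8 * i + p) * (p * r)          ≡⟨ eq₂ p r n i ⟩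
    p * r * (8 * (p * n + i) + p)                        ∎
    where
    eq₁ : ∀ v w → suc (8 * (v + w)) ≡ 8 * v + suc (8 * w)
    eq₁ = solve-∀
    eq₂ : ∀ p r n i → 8 * (p * (p * 1) * r * n) + (8 * i + p) * (p * r) ≡ p * r * (8 * (p * n + i) + p)
    eq₂ = solve-∀

  p∤w : ¬ (p ∣ 8 * (p * n + i) + p)
  -- Modulo `p` the cofactor is 8i, where `p` is an odd prime and 0 < i < p.
  p∤w p∣w with euclidsLemma 8 (p * n + i) pp (∣m+n∣m⇒∣n (subst (p ∣_) (ℕ.+-comm (8 * (p * n + i)) p) p∣w) ∣-refl)
  ... | inj₁ p∣8    = odd-prime∤8 pp 2∤p p∣8
  ... | inj₂ p∣pn+i = ℕ.<⇒≱ i<p (∣⇒≤ (∣m+n∣m⇒∣n p∣pn+i (m∣m*n n)))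
    where
    i<p : i ℕ.< p
    i<p = ℕ.≤-trans (s≤s i≤p-1) (ℕ.≤-reflexive (ℕ.suc-pred p {{prime⇒nonZero pp}}))
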